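{- For every integer $n\ge 1$, $$\mathrm{pf}_n(123,231)=\binom{n+1}{3}+\binom{n}{2}+1.$$
   Context: A Dyck path of semilength $n$ is a lattice path from $(0,0)$ to $(n,n)$ consisting of $n$ north steps $N=(0,1)$ and $n$ east steps $E=(1,0)$ that never goes below the line $y=x$. A parking function of size $n$ is a Dyck path of semilength $n$ whose $n$ north steps are labeled bijectively by $\{1,\dots,n\}$ so that whenever two north steps are consecutive in the path (one immediately following the other), the label of the later one is larger. For a parking function $p$ of size $n$, $\phi(p)$ is the permutation of $\{1,\dots,n\}$ (in one-line notation) obtained by reading the labels of the north steps in the order they occur along the path. A permutation $\pi$ of $\{1,\dots,n\}$ contains a permutation $\rho$ of $\{1,\dots,m\}$ if there are indices $1\le i_1<\cdots<i_m\le n$ such that $\pi_{i_a}\le\pi_{i_b}$ if and only if $\rho_a\le\rho_b$; otherwise $\pi$ avoids $\rho$. For permutations $\rho_1,\dots,\rho_r$, $\mathrm{pf}_n(\rho_1,\dots,\rho_r)$ denotes the number of parking functions $p$ of size $n$ such that $\phi(p)$ avoids each of $\rho_1,\dots,\rho_r$. Binomial coefficients $\binom{a}{b}$ with $0\le a<b$ are $0$. -}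

module Defs where

open import Data.Fin using (Fin) renaming (_<_ to _<ᶠ_)
open import Data.List using (List; []; _∷_; length; lookup; take; applyUpTo)
open import Data.List.Membership.Propositional using (_∈_)
open import Data.List.Relation.Binary.Permutation.Propositional using (_↭_)
open import Data.List.Relation.Unary.All using (All)
open import Data.List.Relation.Unary.Linked using (Linked)
open import Data.List.Relation.Unary.Unique.Propositional using (Unique)
open import Data.Nat using (ℕ; suc; _≤_; _<_)
open import Data.Product using (Σ-syntax; ∃-syntax; _×_; _,_)
open import Data.Unit using (⊤)
open import Function.Bundles using (_⇔_)
open import Relation.Binary.PropositionalEquality using (_≡_)
open import Relation.Nullary using (¬_)

-- Steps of a lattice path; each north step carries its label.
data Step : Set where
  N : (label : ℕ) → Step
  E : Step

endpoint : List Step → ℕ × ℕ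
endpoint []        = 0 , 0
endpoint (N _ ∷ w) = let (x , y) = endpoint w in x , suc y
endpoint (E   ∷ w) = let (x , y) = endpoint w in suc x , y

-- The points visited by w are the endpoints of its prefixes.
record IsDyckPath (n : ℕ) (w : List Step) : Set where
  field
    ends-at-n,n : endpoint w ≡ (n , n)
    never-below : ∀ k → let (x , y) = endpoint (take k w) in x ≤ y

φ : List Step → List ℕ
φ []        = []
φ (N a ∷ w) = a ∷ φ w
φ (E   ∷ w) = φ w

-- One-line notation: xs is a rearrangement of 1 , 2 , … , n.
IsPermutation : ℕ → List ℕ → Set
IsPermutation n xs = xs ↭ applyUpTo suc n

Increasing : Step → Step → Set
Increasing (N a) (N b) = a < b
Increasing _     _     = ⊤

record IsParkingFunction (n : ℕ) (w : List Step) : Set where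
  field
    dyck              : IsDyckPath n w
    labels-bijective  : IsPermutation n (φ w)
    labels-increasing : Linked Increasing w

Contains : (π ρ : List ℕ) → Set
Contains π ρ =
  Σ[ i ∈ (Fin (length ρ) → Fin (length π)) ]
    (∀ a b → a <ᶠ b → i a <ᶠ i b) ×
    (∀ a b → lookup π (i a) ≤ lookup π (i b) ⇔ lookup ρ a ≤ lookup ρ b)

Avoids : (π ρ : List ℕ) → Set
Avoids π ρ = ¬ Contains π ρ

-- Exactly k elements of A satisfy P.
HasCardinality : {A : Set} → (A → Set) → ℕ → Set
HasCardinality {A} P k =
  ∃[ xs ] Unique xs × (∀ (x : A) → x ∈ xs ⇔ P x) × length xs ≡ k

-- pf n ⟨ ρs ⟩≐ k  means  pfₙ(ρ₁,…,ρᵣ) = k.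
pf_⟨_⟩≐_ : ℕ → List (List ℕ) → ℕ → Set
pf n ⟨ ρs ⟩≐ k =
  HasCardinality (λ p → IsParkingFunction n p × All (Avoids (φ p)) ρs) k

{-# OPTIONS --safe #-}
module Submission where

-- If x < y is an ascent (not necessarily adjacent) of a permutation avoiding 123 and 231, every later entry lies strictly
-- between x and y. Hence the permutation is P ++ 1 ∷ M with P and M decreasing, and every entry of P is either above
-- all of M or below all of M. So M is an interval of values, and only the sizes matter.
--
-- North steps of a descent are separated by an east step, so staying above the diagonal forces exactly one east step after
-- each label of P. From the label 1 onwards the path has height 1 until one extra east step occurs, at some
-- point that cuts M = S ++ T. With a entries above M, c below it (other than 1), s = |S| and t = |T|, the words are
-- parametrised by a + s + t + c = n - 1, where all choices with s = t = 0 give the same word.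
-- The solutions with s > 0 number C(n+1,3), those with s = 0 < t number C(n,2).

open import Defs
open import Data.Empty using (⊥-elim)
open import Data.Fin using (Fin; zero; suc) renaming (_<_ to _<ᶠ_)
open import Data.List using (List; []; _∷_; _++_; [_]; length; lookup; take; map; applyUpTo; applyDownFrom)
open import Data.List.Membership.Propositional using (_∈_)
open import Data.List.Membership.Propositional.Properties using (∈-map⁺; ∈-map⁻; ∈-++⁺ˡ; ∈-++⁺ʳ; ∈-++⁻; ∈-∃++)
open import Data.List.Properties
  using (∷-injective; ∷-injectiveˡ; ∷-injectiveʳ; ++-assoc; ++-identityʳ; ++-cancelʳ; length-++; length-map;
         length-applyDownFrom; length-applyUpTo; reverse-applyUpTo; map-cong; map-downFrom)
open import Data.List.Relation.Binary.Permutation.Propositional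
  using (_↭_; ↭-sym; ↭-trans; ↭-reflexive; prep; ↭⇒↭ₛ; module PermutationReasoning)
open import Data.List.Relation.Binary.Permutation.Propositional.Properties
  using (↭-length; ∈-resp-↭; All-resp-↭; ↭-reverse; shift; drop-mid; drop-∷; ¬x∷xs↭[])
  renaming (++⁺ˡ to ↭-++⁺ˡ; ++-comm to ↭-++-comm)
open import Data.List.Relation.Binary.Permutation.Setoid.Properties using (Unique-resp-↭)
open import Data.List.Relation.Binary.Sublist.Propositional using (_⊆_; []; _∷_; _∷ʳ_; ⊆-refl; ⊆-trans; minimum; to∈; from∈)
open import Data.List.Relation.Binary.Sublist.Propositional.Properties using (All-resp-⊆)
import Data.List.Relation.Binary.Sublist.Propositional.Properties as Sublist
open import Data.List.Relation.Unary.All as All using (All; []; _∷_)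
import Data.List.Relation.Unary.All.Properties as All
open import Data.List.Relation.Unary.AllPairs as AllPairs using (AllPairs; []; _∷_)
import Data.List.Relation.Unary.AllPairs.Properties as AllPairs
open import Data.List.Relation.Unary.Any using (here; there)
open import Data.List.Relation.Unary.Linked as Linked using (Linked; []; [-]; _∷_)
open import Data.List.Relation.Unary.Unique.Propositional using (Unique)
import Data.List.Relation.Unary.Unique.Propositional.Properties as Unique
open import Data.Nat using (ℕ; zero; suc; _+_; _≥_; _≤_; _<_; _>_; z≤n; s≤s; s≤s⁻¹)
open import Data.Nat.Combinatorics using (_C_; nCn≡1; nCk+nC[k+1]≡[n+1]C[k+1])
open import Data.Nat.Properties
open import Data.Product using (Σ-syntax; ∃-syntax; ∃₂; _×_; _,_; proj₁; proj₂)
open import Data.Sum using (_⊎_; inj₁; inj₂)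
open import Data.Unit using (tt)
open import Data.Vec as Vec using (Vec; []; _∷_)
open import Function using (_∘_)
open import Function.Bundles using (_⇔_; mk⇔; Equivalence)
open import Relation.Binary.Definitions using (tri<; tri≈; tri>)
open import Relation.Binary.PropositionalEquality hiding ([_])
open import Relation.Nullary using (¬_; contradiction)

Decreasing : List ℕ → Set
Decreasing = AllPairs _>_

AllPairs-resp-⊆ : {A : Set} {R : A → A → Set} {xs ys : List A} → xs ⊆ ys → AllPairs R ys → AllPairs R xs
AllPairs-resp-⊆ []         []         = []
AllPairs-resp-⊆ (_ ∷ʳ p)   (_ ∷ ys)   = AllPairs-resp-⊆ p ys
AllPairs-resp-⊆ (refl ∷ p) (y∼ ∷ ys)  = All-resp-⊆ p y∼ ∷ AllPairs-resp-⊆ p ys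

-- Occurrences of patterns

-- Occurrences of patterns are handled below as sublists; this produces the increasing index map
-- that `Contains` asks for.
sublist-embedding : {xs ys : List ℕ} → xs ⊆ ys →
  Σ[ f ∈ (Fin (length xs) → Fin (length ys)) ]
    (∀ a b → a <ᶠ b → f a <ᶠ f b) × (∀ a → lookup ys (f a) ≡ lookup xs a)
sublist-embedding [] = (λ ()) , (λ ()) , (λ ())
sublist-embedding (_ ∷ʳ p) =
  let f , mono , eq = sublist-embedding p
  in suc ∘ f , (λ a b a<b → s≤s (mono a b a<b)) , eq
sublist-embedding {_ ∷ xs} {_ ∷ ys} (refl ∷ p) = g , g-mono , g-eq
  where
  IH = sublist-embedding p
  g : Fin (suc (length xs)) → Fin (suc (length ys))
  g zero    = zero
  g (suc a) = suc (proj₁ IH a)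
  g-mono : ∀ a b → a <ᶠ b → g a <ᶠ g b
  g-mono zero    (suc b) _         = s≤s z≤n
  g-mono (suc a) (suc b) (s≤s a<b) = s≤s (proj₁ (proj₂ IH) a b a<b)
  g-eq : ∀ a → lookup (_ ∷ ys) (g a) ≡ lookup (_ ∷ xs) a
  g-eq zero    = refl
  g-eq (suc a) = proj₂ (proj₂ IH) a

lookup-⊆ : ∀ (xs : List ℕ) i → [ lookup xs i ] ⊆ xs
lookup-⊆ (x ∷ xs) zero    = refl ∷ minimum xs
lookup-⊆ (x ∷ xs) (suc i) = x ∷ʳ lookup-⊆ xs i

lookup₂-⊆ : ∀ (xs : List ℕ) i j → i <ᶠ j → lookup xs i ∷ lookup xs j ∷ [] ⊆ xs
lookup₂-⊆ (x ∷ xs) zero    (suc j) _         = refl ∷ lookup-⊆ xs j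
lookup₂-⊆ (x ∷ xs) (suc i) (suc j) (s≤s i<j) = x ∷ʳ lookup₂-⊆ xs i j i<j

lookup₃-⊆ : ∀ (xs : List ℕ) i j k → i <ᶠ j → j <ᶠ k → lookup xs i ∷ lookup xs j ∷ lookup xs k ∷ [] ⊆ xs
lookup₃-⊆ (x ∷ xs) zero    (suc j) (suc k) _         (s≤s j<k) = refl ∷ lookup₂-⊆ xs j k j<k
lookup₃-⊆ (x ∷ xs) (suc i) (suc j) (suc k) (s≤s i<j) (s≤s j<k) = x ∷ʳ lookup₃-⊆ xs i j k i<j j<k

SameOrder : (x y x′ y′ : ℕ) → Set
SameOrder x y x′ y′ = (x ≤ y ⇔ x′ ≤ y′) × (y ≤ x ⇔ y′ ≤ x′)

sameOrder-< : ∀ {x y x′ y′} → x < y → x′ < y′ → SameOrder x y x′ y′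
sameOrder-< x<y x′<y′ =
  mk⇔ (λ _ → <⇒≤ x′<y′) (λ _ → <⇒≤ x<y) ,
  mk⇔ (λ y≤x → contradiction y≤x (<⇒≱ x<y)) (λ y′≤x′ → contradiction y′≤x′ (<⇒≱ x′<y′))

sameOrder-sym : ∀ {x y x′ y′} → SameOrder x y x′ y′ → SameOrder y x y′ x′
sameOrder-sym (p , q) = q , p

contains₃ : ∀ {π x y z x′ y′ z′} → x ∷ y ∷ z ∷ [] ⊆ π →
  SameOrder x y x′ y′ → SameOrder x z x′ z′ → SameOrder y z y′ z′ → Contains π (x′ ∷ y′ ∷ z′ ∷ [])
contains₃ {π} {x} {y} {z} {x′} {y′} {z′} p xy xz yz = i , mono , order
  where
  i = proj₁ (sublist-embedding p)
  mono = proj₁ (proj₂ (sublist-embedding p))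
  σ = x ∷ y ∷ z ∷ []
  ρ = x′ ∷ y′ ∷ z′ ∷ []
  order′ : ∀ a b → lookup σ a ≤ lookup σ b ⇔ lookup ρ a ≤ lookup ρ b
  order′ zero             zero             = mk⇔ (λ _ → ≤-refl) (λ _ → ≤-refl)
  order′ zero             (suc zero)       = proj₁ xy
  order′ zero             (suc (suc zero)) = proj₁ xz
  order′ (suc zero)       zero             = proj₂ xy
  order′ (suc zero)       (suc zero)       = mk⇔ (λ _ → ≤-refl) (λ _ → ≤-refl)
  order′ (suc zero)       (suc (suc zero)) = proj₁ yz
  order′ (suc (suc zero)) zero             = proj₂ xz
  order′ (suc (suc zero)) (suc zero)       = proj₂ yz
  order′ (suc (suc zero)) (suc (suc zero)) = mk⇔ (λ _ → ≤-refl) (λ _ → ≤-refl)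
  order : ∀ a b → lookup π (i a) ≤ lookup π (i b) ⇔ lookup ρ a ≤ lookup ρ b
  order a b = subst₂ (λ u v → u ≤ v ⇔ lookup ρ a ≤ lookup ρ b)
    (sym (proj₂ (proj₂ (sublist-embedding p)) a)) (sym (proj₂ (proj₂ (sublist-embedding p)) b)) (order′ a b)

contains₃⁻ : ∀ {π x′ y′ z′} → Contains π (x′ ∷ y′ ∷ z′ ∷ []) →
  ∃[ x ] ∃[ y ] ∃[ z ] x ∷ y ∷ z ∷ [] ⊆ π × SameOrder x y x′ y′ × SameOrder x z x′ z′ × SameOrder y z y′ z′
contains₃⁻ {π} (i , mono , order) =
  _ , _ , _ ,
  lookup₃-⊆ π (i zero) (i (suc zero)) (i (suc (suc zero))) (mono _ _ (s≤s z≤n)) (mono _ _ (s≤s (s≤s z≤n))) ,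
  (order zero (suc zero) , order (suc zero) zero) ,
  (order zero (suc (suc zero)) , order (suc (suc zero)) zero) ,
  (order (suc zero) (suc (suc zero)) , order (suc (suc zero)) (suc zero))

sameOrder⇒< : ∀ {x y x′ y′} → SameOrder x y x′ y′ → x′ < y′ → x < y
sameOrder⇒< (_ , ge) x′<y′ = ≰⇒> (λ y≤x → <⇒≱ x′<y′ (Equivalence.to ge y≤x))

-- Avoidance of 123 and 231 as confinement

123-231 : List (List ℕ)
123-231 = (1 ∷ 2 ∷ 3 ∷ []) ∷ (2 ∷ 3 ∷ 1 ∷ []) ∷ []

-- For lists of distinct entries this amounts to avoiding both patterns: after an ascent `x < y`, an
-- entry above `y` completes a 123 and an entry below `x` a 231.
Confining : List ℕ → Set
Confining π = ∀ {x y z} → x ∷ y ∷ z ∷ [] ⊆ π → x < y → x < z × z < y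

1<2 : 1 < 2
1<2 = ≤-refl

2<3 : 2 < 3
2<3 = ≤-refl

1<3 : 1 < 3
1<3 = s≤s (s≤s z≤n)

confining⇒avoids : ∀ {π} → Confining π → All (Avoids π) 123-231
confining⇒avoids conf =
  (λ c → let _ , _ , _ , p , xy , _ , yz = contains₃⁻ c
         in <-asym (sameOrder⇒< yz 2<3) (proj₂ (conf p (sameOrder⇒< xy 1<2)))) ∷
  (λ c → let _ , _ , _ , p , xy , xz , _ = contains₃⁻ c
         in <-asym (sameOrder⇒< (sameOrder-sym xz) 1<2) (proj₁ (conf p (sameOrder⇒< xy 2<3)))) ∷ []

avoids⇒confining : ∀ {π} → Unique π → All (Avoids π) 123-231 → Confining π
avoids⇒confining uniq (no123 ∷ no231 ∷ []) {x} {y} {z} p x<y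
  with (_ ∷ x≢z ∷ []) ∷ (y≢z ∷ []) ∷ _ ← AllPairs-resp-⊆ p uniq
  with <-cmp x z | <-cmp y z
... | tri≈ _ x≡z _ | _ = contradiction x≡z x≢z
... | _ | tri≈ _ y≡z _ = contradiction y≡z y≢z
... | tri< x<z _ _ | tri> _ _ z<y = x<z , z<y
... | tri> _ _ z<x | _ = contradiction
  (contains₃ p (sameOrder-< x<y 2<3) (sameOrder-sym (sameOrder-< z<x 1<2))
             (sameOrder-sym (sameOrder-< (<-trans z<x x<y) 1<3))) no231
... | _ | tri< y<z _ _ = contradiction
  (contains₃ p (sameOrder-< x<y 1<2) (sameOrder-< (<-trans x<y y<z) 1<3) (sameOrder-< y<z 2<3)) no123

-- Structure of confining lists

Separates : List ℕ → ℕ → Set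
Separates S p = All (p <_) S ⊎ All (_< p) S

-- The entry `y` exceeds everything in `P`, so it can only be found in `S`, and `z` comes after it.
pair-⊆-++ : ∀ {x y z} P S → All (_≤ x) P → x < y → y ∷ z ∷ [] ⊆ P ++ S → y ∷ z ∷ [] ⊆ S
pair-⊆-++ []      S _         _   q          = q
pair-⊆-++ (p ∷ P) S (_ ∷ P≤x) x<y (_ ∷ʳ q)   = pair-⊆-++ P S P≤x x<y q
pair-⊆-++ (p ∷ P) S (p≤x ∷ _) x<y (refl ∷ q) = contradiction p≤x (<⇒≱ x<y)

-- An ascent must go from `P` to `S`. The third entry then follows `y` in the decreasing `S`, hence
-- is below `y`; and since `x` is below one entry of `S`, separation puts it below all of them.
decreasing⇒confining : ∀ {P S} → Decreasing P → Decreasing S → All (Separates S) P → Confining (P ++ S)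
decreasing⇒confining [] decS _ q x<y with (x>y ∷ _) ∷ _ ← AllPairs-resp-⊆ q decS = contradiction x>y (<-asym x<y)
decreasing⇒confining (_ ∷ decP) decS (_ ∷ seps) (_ ∷ʳ q) x<y = decreasing⇒confining decP decS seps q x<y
decreasing⇒confining {_ ∷ P} {S} (x> ∷ _) decS (sep ∷ _) (refl ∷ q) x<y
  with yz⊆S ← pair-⊆-++ P S (All.map <⇒≤ x>) x<y q
  with (y>z ∷ []) ∷ _ ← AllPairs-resp-⊆ yz⊆S decS | sep
... | inj₁ x<S with _ ∷ x<z ∷ [] ← All-resp-⊆ yz⊆S x<S = x<z , y>z
... | inj₂ S<x = contradiction x<y (<-asym (All.lookup S<x (to∈ yz⊆S)))

no-ascent⇒decreasing : ∀ {xs} → Unique xs → (∀ {x y} → x ∷ y ∷ [] ⊆ xs → ¬ x < y) → Decreasing xs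
no-ascent⇒decreasing []            _  = []
no-ascent⇒decreasing (x≢ ∷ uniq) no =
  All.tabulate (λ y∈ → ≤∧≢⇒< (≮⇒≥ (no (refl ∷ from∈ y∈))) (All.lookup x≢ y∈ ∘ sym)) ∷
  no-ascent⇒decreasing uniq (no ∘ (_ ∷ʳ_))

module _ {P S m} (uniq : Unique (P ++ m ∷ S)) (m<P : All (m <_) P) (m<S : All (m <_) S)
         (conf : Confining (P ++ m ∷ S)) where

  -- An ascent in `P` would be followed by `m`, which is too small to lie between its two entries.
  confining⇒decreasingˡ : Decreasing P
  confining⇒decreasingˡ = no-ascent⇒decreasing (AllPairs-resp-⊆ (Sublist.++⁺ʳ (m ∷ S) ⊆-refl) uniq)
    λ {x} q x<y → <-asym (All.lookup m<P (to∈ q)) (proj₁ (conf (Sublist.++⁺ q (refl ∷ minimum S)) x<y))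

  -- If `x` precedes `y` in `S`, then `m < x` is already an ascent, so `y` is confined below `x`.
  confining⇒decreasingʳ : Decreasing S
  confining⇒decreasingʳ = no-ascent⇒decreasing (AllPairs-resp-⊆ (Sublist.++⁺ˡ P (m ∷ʳ ⊆-refl)) uniq)
    λ q x<y → <-asym x<y (proj₂ (conf (Sublist.++⁺ˡ P (refl ∷ q)) (All.lookup m<S (to∈ q))))

  -- Comparing `p` with the first entry of `S` decides the side: if `p` is smaller, confinement
  -- keeps the rest of `S` above `p`; if it is larger, the rest is smaller still because `S`
  -- decreases.
  confining⇒separates : All (Separates S) P
  confining⇒separates = All.tabulate λ {p} p∈P → separates S ⊆-refl confining⇒decreasingʳ p∈P
    where
    separates : ∀ T → T ⊆ S → Decreasing T → ∀ {p} → p ∈ P → Separates T p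
    separates []      _   _          _ = inj₁ []
    separates (y ∷ T) T⊆S (y> ∷ _) {p} p∈P with <-cmp p y
    ... | tri< p<y _ _ = inj₁ (p<y ∷ All.tabulate λ z∈T →
      proj₁ (conf (Sublist.++⁺ (from∈ p∈P) (m ∷ʳ ⊆-trans (refl ∷ from∈ z∈T) T⊆S)) p<y))
    ... | tri> _ _ y<p = inj₂ (y<p ∷ All.map (λ z<y → <-trans z<y y<p) y>)
    ... | tri≈ _ p≡y _ with (p≢y ∷ []) ∷ _ ← AllPairs-resp-⊆
                              (Sublist.++⁺ (from∈ p∈P) (m ∷ʳ ⊆-trans (refl ∷ minimum T) T⊆S)) uniq
                       = contradiction p≡y p≢y

-- Since `P` decreases, once one entry is below all of `S`, so are the later ones; the cut is made
-- there. Inserting `S` at the cut gives the decreasing rearrangement.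
split-above-below : ∀ {P S} → Decreasing P → Decreasing S → All (Separates S) P →
  ∃₂ λ A B → P ≡ A ++ B × Decreasing (A ++ (S ++ B))
split-above-below {S = S} [] decS [] = [] , [] , refl , subst Decreasing (sym (++-identityʳ S)) decS
split-above-below (p> ∷ decP) decS (inj₂ S<p ∷ seps)
  with A , B , refl , dec ← split-above-below decP decS seps
  = _ ∷ A , B , refl , All.++⁺ (All.++⁻ˡ A p>) (All.++⁺ S<p (All.++⁻ʳ A p>)) ∷ dec
split-above-below (p> ∷ decP) decS (inj₁ p<S ∷ _) =
  [] , _ , refl ,
  AllPairs.++⁺ decS (p> ∷ decP) (All.All-swap (p<S ∷ All.map (λ q<p → All.map (<-trans q<p) p<S) p>))

-- Decreasing lists and runs of consecutive integers

decreasing-↭⇒≡ : ∀ {xs ys} → Decreasing xs → Decreasing ys → xs ↭ ys → xs ≡ ys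
decreasing-↭⇒≡ [] [] _ = refl
decreasing-↭⇒≡ [] (_ ∷ _) p = ⊥-elim (¬x∷xs↭[] (↭-sym p))
decreasing-↭⇒≡ (_ ∷ _) [] p = ⊥-elim (¬x∷xs↭[] p)
decreasing-↭⇒≡ {x ∷ _} {y ∷ _} (x> ∷ decx) (y> ∷ decy) p
  -- Each head is the maximum of the same collection of entries, so the heads agree.
  with ≤-antisym (x≤y (∈-resp-↭ p (here refl)) y>) (x≤y (∈-resp-↭ (↭-sym p) (here refl)) x>)
  where
  x≤y : ∀ {x y ys} → x ∈ y ∷ ys → All (y >_) ys → x ≤ y
  x≤y (here refl) _ = ≤-refl
  x≤y (there x∈)  y> = <⇒≤ (All.lookup y> x∈)
... | refl = cong (x ∷_) (decreasing-↭⇒≡ decx decy (drop-∷ p))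

-- run b k = [ b + k - 1 , … , b + 1 , b ]
run : ℕ → ℕ → List ℕ
run b = applyDownFrom (_+ b)

length-run : ∀ b k → length (run b k) ≡ k
length-run b = length-applyDownFrom (_+ b)

run-≥ : ∀ b k → All (b ≤_) (run b k)
run-≥ b k = All.applyDownFrom⁺₂ (_+ b) k (m≤n+m b)

run-< : ∀ b k → All (_< k + b) (run b k)
run-< b k = All.applyDownFrom⁺₁ (_+ b) k (+-monoˡ-< b)

run-decreasing : ∀ b k → Decreasing (run b k)
run-decreasing b k = AllPairs.applyDownFrom⁺₁ (_+ b) k (λ j<i _ → +-monoˡ-< b j<i)

run-++ : ∀ b k j → run b (k + j) ≡ run (j + b) k ++ run b j
run-++ b zero    j = refl
run-++ b (suc k) j = cong₂ _∷_ (+-assoc k j b) (run-++ b k j)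

-- However a run is cut, the lengths of the pieces determine their values; this reduces the
-- classification to sizes.
run-split : ∀ {b k} xs {ys} → run b k ≡ xs ++ ys →
  xs ≡ run (length ys + b) (length xs) × ys ≡ run b (length ys) × k ≡ length xs + length ys
run-split {b} {k} [] refl = refl , cong (run b) (sym (length-run b k)) , sym (length-run b k)
run-split {b} {suc k} (x ∷ xs) {ys} eq
  with refl , eq′ ← ∷-injective eq
  with eq₁ , eq₂ , refl ← run-split xs eq′
  = cong₂ _∷_ (+-assoc (length xs) (length ys) b) eq₁ , eq₂ , refl

run-↭-applyUpTo : ∀ n → 1 ∷ run 2 n ↭ applyUpTo suc (suc n)
run-↭-applyUpTo n = prep 1 (begin
  run 2 n                             ≡⟨ map-downFrom (_+ 2) n ⟨
  map (_+ 2) (applyDownFrom (λ i → i) n) ≡⟨ map-cong (λ i → +-comm i 2) (applyDownFrom (λ i → i) n) ⟩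
  map (2 +_) (applyDownFrom (λ i → i) n) ≡⟨ map-downFrom (2 +_) n ⟩
  applyDownFrom (2 +_) n              ≡⟨ reverse-applyUpTo (2 +_) n ⟨
  _                                   ↭⟨ ↭-reverse (applyUpTo (2 +_) n) ⟩
  applyUpTo (2 +_) n                  ∎)
  where open PermutationReasoning

-- Lattice words

-- The index is the height `y - x` above the diagonal at the start of the word. An east step needs
-- positive height, which replaces the condition on prefixes by a recursive one.
data DyckFrom : ℕ → List Step → Set where
  []  : DyckFrom 0 []
  N∷_ : ∀ {h a w} → DyckFrom (suc h) w → DyckFrom h (N a ∷ w)
  E∷_ : ∀ {h w} → DyckFrom h w → DyckFrom (suc h) (E ∷ w)

endpoint-y : ∀ w → proj₂ (endpoint w) ≡ length (φ w)
endpoint-y []        = refl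
endpoint-y (N _ ∷ w) = cong suc (endpoint-y w)
endpoint-y (E ∷ w)   = endpoint-y w

dyckFrom⇒endpoint : ∀ {h w} → DyckFrom h w → proj₁ (endpoint w) ≡ h + proj₂ (endpoint w)
dyckFrom⇒endpoint [] = refl
dyckFrom⇒endpoint {h} (N∷ d) = trans (dyckFrom⇒endpoint d) (sym (+-suc h _))
dyckFrom⇒endpoint (E∷ d) = cong suc (dyckFrom⇒endpoint d)

dyckFrom⇒never-below : ∀ {h w} → DyckFrom h w → ∀ k →
  proj₁ (endpoint (take k w)) ≤ h + proj₂ (endpoint (take k w))
dyckFrom⇒never-below _ zero = z≤n
dyckFrom⇒never-below [] (suc k) = z≤n
dyckFrom⇒never-below {h} (N∷ d) (suc k) = ≤-trans (dyckFrom⇒never-below d k) (≤-reflexive (sym (+-suc h _)))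
dyckFrom⇒never-below (E∷ d) (suc k) = s≤s (dyckFrom⇒never-below d k)

endpoint⇒dyckFrom : ∀ h w → proj₁ (endpoint w) ≡ h + proj₂ (endpoint w) →
  (∀ k → proj₁ (endpoint (take k w)) ≤ h + proj₂ (endpoint (take k w))) → DyckFrom h w
endpoint⇒dyckFrom zero [] _ _ = []
endpoint⇒dyckFrom h (N a ∷ w) eq nb = N∷ endpoint⇒dyckFrom (suc h) w (trans eq (+-suc h _))
  (λ k → ≤-trans (nb (suc k)) (≤-reflexive (+-suc h _)))
-- At height 0 the prefix consisting of this single east step already lies below the diagonal.
endpoint⇒dyckFrom zero (E ∷ w) eq nb with () ← nb 1
endpoint⇒dyckFrom (suc h) (E ∷ w) eq nb = E∷ endpoint⇒dyckFrom h w (suc-injective eq) (s≤s⁻¹ ∘ nb ∘ suc)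

-- Zigzag words and their uniqueness

zig : List ℕ → List Step
zig []       = []
zig (x ∷ xs) = N x ∷ E ∷ zig xs

-- The label `m` raises the path by one level; the `E` between `zig S` and `zig T` is the delayed
-- step that brings it back.
word : List ℕ → ℕ → List ℕ → List ℕ → List Step
word P m S T = zig P ++ N m ∷ zig S ++ E ∷ zig T

φ-zig-++ : ∀ xs w → φ (zig xs ++ w) ≡ xs ++ φ w
φ-zig-++ []       w = refl
φ-zig-++ (x ∷ xs) w = cong (x ∷_) (φ-zig-++ xs w)

φ-zig : ∀ xs → φ (zig xs) ≡ xs
φ-zig []       = refl
φ-zig (x ∷ xs) = cong (x ∷_) (φ-zig xs)

φ-word : ∀ P m S T → φ (word P m S T) ≡ P ++ m ∷ (S ++ T)
φ-word P m S T = trans (φ-zig-++ P _)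
  (cong (λ r → P ++ m ∷ r) (trans (φ-zig-++ S _) (cong (S ++_) (φ-zig T))))

zig-++-dyckFrom : ∀ {h w} xs → DyckFrom h w → DyckFrom h (zig xs ++ w)
zig-++-dyckFrom []       d = d
zig-++-dyckFrom (x ∷ xs) d = N∷ (E∷ zig-++-dyckFrom xs d)

zig-dyckFrom : ∀ xs → DyckFrom 0 (zig xs)
zig-dyckFrom []       = []
zig-dyckFrom (x ∷ xs) = N∷ (E∷ zig-dyckFrom xs)

word-dyckFrom : ∀ P m S T → DyckFrom 0 (word P m S T)
word-dyckFrom P m S T = zig-++-dyckFrom P (N∷ zig-++-dyckFrom S (E∷ zig-dyckFrom T))

E∷-linked : ∀ {w} → Linked Increasing w → Linked Increasing (E ∷ w)
E∷-linked []          = [-]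
E∷-linked [-]         = tt ∷ [-]
E∷-linked (r ∷ linked) = tt ∷ r ∷ linked

zig-++-linked : ∀ {w} xs → Linked Increasing w → Linked Increasing (zig xs ++ w)
zig-++-linked []       linked = linked
zig-++-linked (x ∷ xs) linked = tt ∷ E∷-linked (zig-++-linked xs linked)

zig-linked : ∀ xs → Linked Increasing (zig xs)
zig-linked []       = []
zig-linked (x ∷ xs) = tt ∷ E∷-linked (zig-linked xs)

-- The only possible pair of consecutive north steps is `m` and the first entry of `S`.
word-linked : ∀ P {m} S T → All (m <_) S → Linked Increasing (word P m S T)
word-linked P {m} S T m<S = zig-++-linked P (peak S m<S)
  where
  peak : ∀ S → All (m <_) S → Linked Increasing (N m ∷ zig S ++ E ∷ zig T)
  peak []      _         = tt ∷ E∷-linked (zig-linked T)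
  peak (s ∷ S) (m<s ∷ _) = m<s ∷ zig-++-linked (s ∷ S) (E∷-linked (zig-linked T))

zig-injective : ∀ {xs ys} → zig xs ≡ zig ys → xs ≡ ys
zig-injective {xs} {ys} eq = trans (sym (φ-zig xs)) (trans (cong φ eq) (φ-zig ys))

-- Reading the word in pairs `N E`, the first pair position occupied by an east step marks the end
-- of `S`.
zig-E-injective : ∀ S S′ {v v′} → zig S ++ E ∷ v ≡ zig S′ ++ E ∷ v′ → S ≡ S′ × v ≡ v′
zig-E-injective []      []       refl = refl , refl
zig-E-injective []      (_ ∷ _)  ()
zig-E-injective (_ ∷ _) []       ()
zig-E-injective (s ∷ S) (s′ ∷ S′) eq
  with refl ← ∷-injectiveˡ eq
  with S≡ , v≡ ← zig-E-injective S S′ (∷-injectiveʳ (∷-injectiveʳ eq))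
  = cong (s ∷_) S≡ , v≡

-- All labels of `P` and `P′` exceed `m`, so the first occurrence of `m` marks where each of them
-- ends.
zig-N-injective : ∀ {m} P P′ {v v′} → All (m <_) P → All (m <_) P′ →
  zig P ++ N m ∷ v ≡ zig P′ ++ N m ∷ v′ → P ≡ P′ × v ≡ v′
zig-N-injective []      []        _         _          refl = refl , refl
zig-N-injective []      (_ ∷ _)   _         (m<m ∷ _)  refl = contradiction m<m (<-irrefl refl)
zig-N-injective (_ ∷ _) []        (m<m ∷ _) _          refl = contradiction m<m (<-irrefl refl)
zig-N-injective (p ∷ P) (p′ ∷ P′) (_ ∷ m<P) (_ ∷ m<P′) eq
  with refl ← ∷-injectiveˡ eq
  with P≡ , v≡ ← zig-N-injective P P′ m<P m<P′ (∷-injectiveʳ (∷-injectiveʳ eq))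
  = cong (p ∷_) P≡ , v≡

word-injective : ∀ {m P P′ S S′ T T′} → All (m <_) P → All (m <_) P′ →
  word P m S T ≡ word P′ m S′ T′ → P ≡ P′ × S ≡ S′ × T ≡ T′
word-injective {m} {P} {P′} {S} {S′} m<P m<P′ eq
  with P≡ , v≡ ← zig-N-injective P P′ m<P m<P′ eq
  with S≡ , T≡ ← zig-E-injective S S′ v≡
  = P≡ , S≡ , zig-injective T≡

-- Two consecutive north steps would be an ascent of φ w.
decreasing-zig : ∀ {w} → DyckFrom 0 w → Linked Increasing w → Decreasing (φ w) → ∃[ xs ] w ≡ zig xs
decreasing-zig [] _ _ = [] , refl
decreasing-zig (N∷ (N∷ _)) (x<y ∷ _) ((x>y ∷ _) ∷ _) = contradiction x>y (<-asym x<y)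
decreasing-zig (N∷_ {a = x} (E∷ d)) (_ ∷ linked) (_ ∷ dec) =
  let xs , eq = decreasing-zig d (Linked.tail linked) dec in x ∷ xs , cong (λ w → N x ∷ E ∷ w) eq

-- As labels cannot be consecutive, each is followed at once by an east step back to height 1. The
-- first east step taken from height 1 ends `S`; from there `decreasing-zig` applies.
decreasing-zig-E-zig : ∀ {w} → DyckFrom 1 w → Linked Increasing w → Decreasing (φ w) →
  ∃₂ λ S T → w ≡ zig S ++ E ∷ zig T
decreasing-zig-E-zig (E∷ d) linked dec =
  let T , eq = decreasing-zig d (Linked.tail linked) dec in [] , T , cong (E ∷_) eq
decreasing-zig-E-zig (N∷ (N∷ _)) (x<y ∷ _) ((x>y ∷ _) ∷ _) = contradiction x>y (<-asym x<y)
decreasing-zig-E-zig (N∷_ {a = x} (E∷ d)) (_ ∷ linked) (_ ∷ dec) =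
  let S , T , eq = decreasing-zig-E-zig d (Linked.tail linked) dec in x ∷ S , T , cong (λ w → N x ∷ E ∷ w) eq

-- Two consecutive north steps inside `P`, or from its last entry to `m`, would be an ascent. So
-- every entry of `P` is followed by an east step, and at height 0 by no more than one.
decreasing-zig-N : ∀ {w} P {m S} → DyckFrom 0 w → Linked Increasing w → Decreasing P → All (m <_) P →
  φ w ≡ P ++ m ∷ S → ∃[ v ] w ≡ zig P ++ N m ∷ v × DyckFrom 1 v × Linked Increasing v × φ v ≡ S
decreasing-zig-N [] (N∷ d) linked _ _ refl = _ , refl , d , Linked.tail linked , refl
decreasing-zig-N (p ∷ []) (N∷ (N∷ _)) (p<m ∷ _) _ (m<p ∷ _) refl = contradiction m<p (<-asym p<m)
decreasing-zig-N (p ∷ q ∷ P) (N∷ (N∷ _)) (p<q ∷ _) ((p>q ∷ _) ∷ _) _ eq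
  with refl , eq′ ← ∷-injective eq
  with refl ← ∷-injectiveˡ eq′ = contradiction p>q (<-asym p<q)
decreasing-zig-N (p ∷ P) (N∷ (E∷ d)) (_ ∷ linked) (_ ∷ dec) (_ ∷ m<P) eq
  with refl , eq′ ← ∷-injective eq
  = let v , w≡ , rest = decreasing-zig-N P d (Linked.tail linked) dec m<P eq′
    in v , cong (λ w → N p ∷ E ∷ w) w≡ , rest

-- The four-parameter family of blocks

-- The values 2 , … , a+s+t+c+1 are cut into runs; the word reads the a largest and the c smallest of them, then 1,
-- then the remaining s+t, with the delayed east step after the first s of these.
above-below : (a s t c : ℕ) → List ℕ
above-below a s t c = run (s + (t + (c + 2))) a ++ run 2 c

between : (s t c : ℕ) → List ℕ
between s t c = run (t + (c + 2)) s ++ run (c + 2) t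

block : (a s t c : ℕ) → List Step
block a s t c = word (above-below a s t c) 1 (run (t + (c + 2)) s) (run (c + 2) t)

Counted : ℕ → List Step → Set
Counted n w = IsParkingFunction n w × All (Avoids (φ w)) 123-231

rotate : ∀ {A : Set} (xs ys zs : List A) → (xs ++ ys) ++ zs ↭ xs ++ (zs ++ ys)
rotate xs ys zs = ↭-trans (↭-reflexive (++-assoc xs ys zs)) (↭-++⁺ˡ xs (↭-++-comm ys zs))

2≤m+[n+2] : ∀ m n → 2 ≤ m + (n + 2)
2≤m+[n+2] m n = ≤-trans (m≤n+m 2 n) (m≤n+m (n + 2) m)

above-below-> : ∀ a s t c → All (1 <_) (above-below a s t c)
above-below-> a s t c = All.++⁺
  (All.map (≤-trans (≤-trans (2≤m+[n+2] t c) (m≤n+m _ s))) (run-≥ (s + (t + (c + 2))) a)) (run-≥ 2 c)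

between≡run : ∀ s t c → between s t c ≡ run (c + 2) (s + t)
between≡run s t c = sym (run-++ (c + 2) s t)

-- Moving the middle labels between the upper and the lower run makes the runs abut, giving all
-- values from 2 upwards in decreasing order.
block-↭ : ∀ a s t c → φ (block a s t c) ↭ applyUpTo suc (suc (a + (s + (t + c))))
block-↭ a s t c = begin
  φ (block a s t c)                           ≡⟨ φ-word P 1 _ _ ⟩
  P ++ 1 ∷ between s t c                      ↭⟨ shift 1 P (between s t c) ⟩
  1 ∷ (A ++ B) ++ between s t c               ↭⟨ prep 1 (rotate A B (between s t c)) ⟩
  1 ∷ A ++ (between s t c ++ B)               ≡⟨ cong (λ r → 1 ∷ A ++ r) runs ⟩
  1 ∷ A ++ run 2 (s + (t + c))                ≡⟨ cong (λ b → 1 ∷ run b a ++ run 2 (s + (t + c))) base ⟩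
  1 ∷ run (s + (t + c) + 2) a ++ run 2 (s + (t + c)) ≡⟨ cong (1 ∷_) (run-++ 2 a (s + (t + c))) ⟨
  1 ∷ run 2 (a + (s + (t + c)))               ↭⟨ run-↭-applyUpTo _ ⟩
  applyUpTo suc (suc (a + (s + (t + c))))     ∎
  where
  open PermutationReasoning
  A = run (s + (t + (c + 2))) a
  B = run 2 c
  P = above-below a s t c
  base : s + (t + (c + 2)) ≡ s + (t + c) + 2
  base = trans (cong (s +_) (sym (+-assoc t c 2))) (sym (+-assoc s (t + c) 2))
  runs : between s t c ++ B ≡ run 2 (s + (t + c))
  runs = trans (cong (_++ B) (between≡run s t c))
    (trans (sym (run-++ 2 (s + t) c)) (cong (run 2) (+-assoc s t c)))

-- The label 1 is counted with the decreasing left part. The upper run lies above the middle labels;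
-- the lower run and 1 lie below them.
block-confining : ∀ a s t c → Confining (φ (block a s t c))
block-confining a s t c = subst Confining
  (trans (++-assoc P [ 1 ] M) (sym (φ-word P 1 _ _)))
  (decreasing⇒confining
    (AllPairs.++⁺ (AllPairs.++⁺ (run-decreasing _ a) (run-decreasing 2 c)
                    (All.map (λ B<a → All.map (λ x< → <-≤-trans x< B<a) B<) (All.map (≤-trans c+2≤) (run-≥ _ a))))
                  ([] ∷ [])
                  (All.map (_∷ []) (above-below-> a s t c)))
    (subst Decreasing (sym (between≡run s t c)) (run-decreasing _ (s + t)))
    (All.++⁺ (All.++⁺ (All.map (λ x≥ → inj₂ (All.map (λ y< → <-≤-trans y< x≥) M<)) (run-≥ _ a))
                      (All.map (λ x< → inj₁ (All.map (<-≤-trans x<) M≥)) B<))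
             (inj₁ (All.map (<-≤-trans (m≤n+m 2 c)) M≥) ∷ [])))
  where
  P = above-below a s t c
  M = between s t c
  B< : All (_< c + 2) (run 2 c)
  B< = run-< 2 c
  c+2≤ : c + 2 ≤ s + (t + (c + 2))
  c+2≤ = ≤-trans (m≤n+m _ t) (m≤n+m _ s)
  M≥ : All (c + 2 ≤_) M
  M≥ = subst (All _) (sym (between≡run s t c)) (run-≥ (c + 2) (s + t))
  M< : All (_< s + (t + (c + 2))) M
  M< = subst (All _) (sym (between≡run s t c))
    (subst (λ b → All (_< b) (run (c + 2) (s + t))) (+-assoc s t (c + 2)) (run-< (c + 2) (s + t)))

dyckFrom⇒isDyckPath : ∀ {n w} → DyckFrom 0 w → IsPermutation n (φ w) → IsDyckPath n w
dyckFrom⇒isDyckPath {n} {w} d perm = record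
  { ends-at-n,n = cong₂ _,_ (trans (dyckFrom⇒endpoint d) y≡n) y≡n
  ; never-below = dyckFrom⇒never-below d }
  where
  y≡n : proj₂ (endpoint w) ≡ n
  y≡n = trans (endpoint-y w) (trans (↭-length perm) (length-applyUpTo suc n))

block-counted : ∀ a s t c {n} → a + (s + (t + c)) ≡ n → Counted (suc n) (block a s t c)
block-counted a s t c refl =
  record
    { dyck              = dyckFrom⇒isDyckPath (word-dyckFrom (above-below a s t c) 1 _ _) (block-↭ a s t c)
    ; labels-bijective  = block-↭ a s t c
    ; labels-increasing = word-linked (above-below a s t c) _ _
                            (All.map (≤-trans (2≤m+[n+2] t c)) (run-≥ (t + (c + 2)) s)) } ,
  confining⇒avoids (block-confining a s t c)

-- Every counted word is a block

IsBlock : ℕ → List Step → Set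
IsBlock n w = ∃[ a ] ∃[ s ] ∃[ t ] ∃[ c ] a + (s + (t + c)) ≡ n × w ≡ block a s t c

-- Three successive cuts of one run identify `A`, `S`, `T` and `B` as runs whose bases are fixed by
-- the lengths of the pieces after them.
word-of-runs : ∀ {n} A B S T → run 2 n ≡ A ++ (S ++ (T ++ B)) → IsBlock n (word (A ++ B) 1 S T)
word-of-runs {n} A B S T eq
  with A≡ , eqSTC , n≡ ← run-split A eq
  with S≡ , eqTC , l≡ ← run-split S (sym eqSTC)
  with T≡ , B≡ , l′≡ ← run-split T (sym eqTC)
  = a , s , t , c , sym (trans n≡ (cong (a +_) (trans l≡ (cong (s +_) l′≡)))) , word≡
  where
  a = length A
  s = length S
  t = length T
  c = length B
  baseS : length (T ++ B) + 2 ≡ t + (c + 2)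
  baseS = trans (cong (_+ 2) l′≡) (+-assoc t c 2)
  baseA : length (S ++ (T ++ B)) + 2 ≡ s + (t + (c + 2))
  baseA = trans (cong (_+ 2) l≡) (trans (+-assoc s _ 2) (cong (s +_) baseS))
  word≡ : word (A ++ B) 1 S T ≡ block a s t c
  word≡ = trans
    (cong₂ (λ A B → word (A ++ B) 1 S T) (trans A≡ (cong (λ b → run b a) baseA)) B≡)
    (cong₂ (word (above-below a s t c) 1) (trans S≡ (cong (λ b → run b s) baseS)) T≡)

counted⇒block : ∀ {n w} → Counted (suc n) w → IsBlock n w
counted⇒block {n} {w} (pf , avoids)
  with P , R , φ≡ ← ∈-∃++ (∈-resp-↭ (↭-sym (IsParkingFunction.labels-bijective pf)) (here refl))
  = result
  where
  open IsParkingFunction pf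
  open IsDyckPath dyck

  unique : Unique (P ++ 1 ∷ R)
  unique = subst Unique φ≡ (Unique-resp-↭ (setoid ℕ) (↭⇒↭ₛ (↭-sym labels-bijective))
    (Unique.applyUpTo⁺₁ suc (suc n) (λ i<j _ → <⇒≢ i<j ∘ suc-injective)))

  PR↭run : P ++ R ↭ run 2 n
  -- Deleting the label 1 from both sides leaves the values from 2 to `n + 1`.
  PR↭run = drop-mid P [] (↭-trans (↭-reflexive (sym φ≡)) (↭-trans labels-bijective (↭-sym (run-↭-applyUpTo n))))

  1<PR : All (1 <_) (P ++ R)
  1<PR = All-resp-↭ (↭-sym PR↭run) (run-≥ 2 n)

  1<P = All.++⁻ˡ P 1<PR
  1<R = All.++⁻ʳ P 1<PR

  confining : Confining (P ++ 1 ∷ R)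
  confining = subst Confining φ≡ (avoids⇒confining (subst Unique (sym φ≡) unique) avoids)

  decP = confining⇒decreasingˡ unique 1<P 1<R confining
  decR = confining⇒decreasingʳ unique 1<P 1<R confining

  dyckFrom : DyckFrom 0 w
  dyckFrom = endpoint⇒dyckFrom 0 w
    (trans (cong proj₁ ends-at-n,n) (sym (cong proj₂ ends-at-n,n))) never-below

  result : IsBlock n w
  result
    with A , B , refl , decARB ← split-above-below decP decR (confining⇒separates unique 1<P 1<R confining)
    with v , refl , dyckv , linkedv , refl ← decreasing-zig-N (A ++ B) dyckFrom labels-increasing decP 1<P φ≡
    with S , T , refl ← decreasing-zig-E-zig dyckv linkedv decR
    = word-of-runs A B S T
        -- Both lists are decreasing rearrangements of the same values, so `A ++ (R ++ B)` is the
        -- run itself, with `R` here being `φ v`.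
        (trans (sym (decreasing-↭⇒≡ decARB (run-decreasing 2 n) (↭-trans (↭-sym (rotate A B R)) PR↭run)))
               (cong (A ++_) (trans (cong (_++ B) φv≡) (++-assoc S T B))))
    where
    φv≡ : φ v ≡ S ++ T
    φv≡ = trans (φ-zig-++ S _) (cong (S ++_) (φ-zig T))

-- Which parameters a block determines

above-below-injective : ∀ s t c {a a′} → above-below a s t c ≡ above-below a′ s t c → a ≡ a′
above-below-injective s t c {a} {a′} eq = trans (sym (length-run b a))
  (trans (cong length (++-cancelʳ (run 2 c) (run b a) (run b a′) eq)) (length-run b a′))
  where b = s + (t + (c + 2))

run-injective : ∀ {b b′ k k′} → run b k ≡ run b′ k′ → k ≡ k′
run-injective {b} {b′} {k} {k′} eq = trans (sym (length-run b k)) (trans (cong length eq) (length-run b′ k′))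

run-injectiveᵇ : ∀ {b b′} k → run b (suc k) ≡ run b′ (suc k) → b ≡ b′
run-injectiveᵇ {b} {b′} k eq = +-cancelˡ-≡ k b b′ (∷-injectiveˡ eq)

block-injective : ∀ {a a′ s s′ t t′ c c′} → block a s t c ≡ block a′ s′ t′ c′ → s ≡ s′ × t ≡ t′
block-injective {a} {a′} {s} {s′} {t} {t′} {c} {c′} eq =
  let _ , S≡ , T≡ = word-injective (above-below-> a s t c) (above-below-> a′ s′ t′ c′) eq
  in run-injective S≡ , run-injective T≡

-- A nonempty run reveals its base through its head, and the base of a middle run reveals `c`.
base-injective : ∀ {c c′} s t → 0 < s + t →
  run (t + (c + 2)) s ≡ run (t + (c′ + 2)) s → run (c + 2) t ≡ run (c′ + 2) t → c ≡ c′
base-injective s       (suc t) _ _  T≡ = +-cancelʳ-≡ 2 _ _ (run-injectiveᵇ t T≡)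
base-injective (suc s) zero    _ S≡ _  = +-cancelʳ-≡ 2 _ _ (run-injectiveᵇ s S≡)

block-injectiveᵃᶜ : ∀ {a a′ s t c c′} → 0 < s + t → block a s t c ≡ block a′ s t c′ → a ≡ a′ × c ≡ c′
block-injectiveᵃᶜ {a} {a′} {s} {t} {c} {c′} 0<s+t eq
  with P≡ , S≡ , T≡ ← word-injective (above-below-> a s t c) (above-below-> a′ s t c′) eq
  with refl ← base-injective s t 0<s+t S≡ T≡
  = above-below-injective s t c P≡ , refl

-- Without middle labels the upper and lower runs abut, so only `a + c` is visible. This is the sole
-- coincidence among blocks.
block-merge : ∀ a c → block a 0 0 c ≡ block 0 0 0 (a + c)
block-merge a c = cong (λ P → word P 1 [] []) (sym (run-++ 2 a c))

-- Weak compositions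

sum₁ : ∀ {k} → Vec ℕ (suc k) → ℕ
sum₁ = Vec.foldr₁ _+_

bump : ∀ {k} → Vec ℕ (suc k) → Vec ℕ (suc k)
bump (x ∷ xs) = suc x ∷ xs

-- Lists the vectors of `k + 1` naturals with sum `m`: either the first part is 0, or one unit can
-- be taken off it.
compositions : ∀ k → ℕ → List (Vec ℕ (suc k))
compositions zero    m       = [ m ∷ [] ]
compositions (suc k) zero    = map (0 ∷_) (compositions k zero)
compositions (suc k) (suc m) = map (0 ∷_) (compositions k (suc m)) ++ map bump (compositions (suc k) m)

sum₁-0∷ : ∀ {k} (v : Vec ℕ (suc k)) → sum₁ (0 ∷ v) ≡ sum₁ v
sum₁-0∷ (_ ∷ _) = refl

sum₁-bump : ∀ {k} (v : Vec ℕ (suc k)) → sum₁ (bump v) ≡ suc (sum₁ v)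
sum₁-bump (_ ∷ [])    = refl
sum₁-bump (_ ∷ _ ∷ _) = refl

∈-compositions⁺ : ∀ {k} (v : Vec ℕ (suc k)) → v ∈ compositions k (sum₁ v)
∈-compositions⁺ (x ∷ []) = here refl
∈-compositions⁺ (zero ∷ v@(_ ∷ _)) = go (sum₁ v) (∈-compositions⁺ v)
  where
  go : ∀ {k} {v : Vec ℕ (suc k)} m → v ∈ compositions k m → (0 ∷ v) ∈ compositions (suc k) m
  go zero    v∈ = ∈-map⁺ (0 ∷_) v∈
  go (suc m) v∈ = ∈-++⁺ˡ (∈-map⁺ (0 ∷_) v∈)
∈-compositions⁺ (suc x ∷ v@(_ ∷ _)) = ∈-++⁺ʳ _ (∈-map⁺ bump (∈-compositions⁺ (x ∷ v)))

sum₁-compositions : ∀ k m → All (λ v → sum₁ v ≡ m) (compositions k m)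
sum₁-compositions zero    m       = refl ∷ []
sum₁-compositions (suc k) zero    =
  All.map⁺ (All.map (λ {v} eq → trans (sum₁-0∷ v) eq) (sum₁-compositions k zero))
sum₁-compositions (suc k) (suc m) = All.++⁺
  (All.map⁺ (All.map (λ {v} eq → trans (sum₁-0∷ v) eq) (sum₁-compositions k (suc m))))
  (All.map⁺ (All.map (λ {v} eq → trans (sum₁-bump v) (cong suc eq)) (sum₁-compositions (suc k) m)))

compositions-unique : ∀ k m → Unique (compositions k m)
compositions-unique zero    m       = [] ∷ []
compositions-unique (suc k) zero    = Unique.map⁺ (λ { refl → refl }) (compositions-unique k zero)
compositions-unique (suc k) (suc m) = Unique.++⁺
  (Unique.map⁺ (λ { refl → refl }) (compositions-unique k (suc m)))
  (Unique.map⁺ (λ { {_ ∷ _} {_ ∷ _} refl → refl }) (compositions-unique (suc k) m))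
  (λ { (p , q) → disjoint (∈-map⁻ (0 ∷_) p) (∈-map⁻ bump q) })
  where
  disjoint : ∀ {v : Vec ℕ (suc (suc k))} {us us′} →
    (∃[ u ] u ∈ us × v ≡ 0 ∷ u) → ¬ (∃[ u ] u ∈ us′ × v ≡ bump u)
  disjoint (_ , _ , refl) (_ ∷ _ , _ , ())

-- The two cases of the recursion add up by Pascal's rule.
length-compositions : ∀ k m → length (compositions k m) ≡ (m + k) C k
length-compositions zero    m       = cong (_C 0) (sym (+-identityʳ m))
length-compositions (suc k) zero    = trans (length-map (0 ∷_) (compositions k zero))
  (trans (length-compositions k zero) (trans (nCn≡1 k) (sym (nCn≡1 (suc k)))))
length-compositions (suc k) (suc m) = begin
  length (map (0 ∷_) (compositions k (suc m)) ++ map bump (compositions (suc k) m))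
    ≡⟨ length-++ (map (0 ∷_) (compositions k (suc m))) ⟩
  length (map (0 ∷_) (compositions k (suc m))) + length (map bump (compositions (suc k) m))
    ≡⟨ cong₂ _+_ (length-map (0 ∷_) (compositions k (suc m))) (length-map bump (compositions (suc k) m)) ⟩
  length (compositions k (suc m)) + length (compositions (suc k) m)
    ≡⟨ cong₂ _+_ (length-compositions k (suc m)) (length-compositions (suc k) m) ⟩
  suc (m + k) C k + (m + suc k) C suc k
    ≡⟨ cong (λ n → n C k + (m + suc k) C suc k) (+-suc m k) ⟨
  (m + suc k) C k + (m + suc k) C suc k
    ≡⟨ nCk+nC[k+1]≡[n+1]C[k+1] (m + suc k) k ⟩
  suc (m + suc k) C suc k ∎
  where open ≡-Reasoning

-- Enumeration and count

straight : Vec ℕ 3 → List Step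
straight (a ∷ t ∷ c ∷ []) = block a 0 (suc t) c

-- Positivity is encoded by the successor: `suc s` here, and `suc t` with `s = 0` in `straight`.
delayed : Vec ℕ 4 → List Step
delayed (a ∷ s ∷ t ∷ c ∷ []) = block a (suc s) t c

straight-injective : ∀ {u v} → straight u ≡ straight v → u ≡ v
straight-injective {a ∷ t ∷ c ∷ []} {a′ ∷ t′ ∷ c′ ∷ []} eq
  with _ , refl ← block-injective {a} {a′} {0} {0} {suc t} {suc t′} {c} {c′} eq
  with refl , refl ← block-injectiveᵃᶜ {a} {a′} {0} {suc t} {c} {c′} (s≤s z≤n) eq
  = refl

delayed-injective : ∀ {u v} → delayed u ≡ delayed v → u ≡ v
delayed-injective {a ∷ s ∷ t ∷ c ∷ []} {a′ ∷ s′ ∷ t′ ∷ c′ ∷ []} eq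
  with refl , refl ← block-injective {a} {a′} {suc s} {suc s′} {t} {t′} {c} {c′} eq
  with refl , refl ← block-injectiveᵃᶜ {a} {a′} {suc s} {t} {c} {c′} (s≤s z≤n) eq
  = refl

-- The positive parameter absorbs one unit, so the remaining parts sum to `m` rather than `suc m`.
nontrivial : ℕ → List (List Step)
nontrivial zero    = []
nontrivial (suc m) = map straight (compositions 2 m) ++ map delayed (compositions 3 m)

enumeration : ℕ → List (List Step)
enumeration n = block 0 0 0 n ∷ nontrivial n

-- The pair `(s , t)` can be read off a block, and it tells the three families apart.
enumeration-unique : ∀ n → Unique (enumeration n)
enumeration-unique zero    = [] ∷ []
enumeration-unique (suc m) =
  All.++⁺ (All.map⁺ (All.universal ≢straight (compositions 2 m))) (All.map⁺ (All.universal ≢delayed (compositions 3 m))) ∷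
  Unique.++⁺ (Unique.map⁺ straight-injective (compositions-unique 2 m))
             (Unique.map⁺ delayed-injective (compositions-unique 3 m))
             (λ { (p , q) → disjoint (∈-map⁻ straight p) (∈-map⁻ delayed q) })
  where
  ≢straight : ∀ v → block 0 0 0 (suc m) ≢ straight v
  ≢straight (a ∷ t ∷ c ∷ []) eq
    with _ , () ← block-injective {0} {a} {0} {0} {0} {suc t} {suc m} {c} eq
  ≢delayed : ∀ v → block 0 0 0 (suc m) ≢ delayed v
  ≢delayed (a ∷ s ∷ t ∷ c ∷ []) eq
    with () , _ ← block-injective {0} {a} {0} {suc s} {0} {t} {suc m} {c} eq
  disjoint : ∀ {w us vs} → (∃[ u ] u ∈ us × w ≡ straight u) → ¬ (∃[ v ] v ∈ vs × w ≡ delayed v)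
  disjoint (a ∷ t ∷ c ∷ [] , _ , refl) (a′ ∷ s′ ∷ t′ ∷ c′ ∷ [] , _ , eq)
    with () , _ ← block-injective {a} {a′} {0} {suc s′} {suc t} {t′} {c} {c′} eq

∈-enumeration⁻ : ∀ n {w} → w ∈ enumeration n → Counted (suc n) w
∈-enumeration⁻ n       (here refl) = block-counted 0 0 0 n refl
∈-enumeration⁻ (suc m) (there w∈) with ∈-++⁻ (map straight (compositions 2 m)) w∈
... | inj₁ w∈′ with a ∷ t ∷ c ∷ [] , v∈ , refl ← ∈-map⁻ straight w∈′ =
  block-counted a 0 (suc t) c (trans (+-suc a (t + c)) (cong suc (All.lookup (sum₁-compositions 2 m) v∈)))
... | inj₂ w∈′ with a ∷ s ∷ t ∷ c ∷ [] , v∈ , refl ← ∈-map⁻ delayed w∈′ =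
  block-counted a (suc s) t c (trans (+-suc a (s + (t + c))) (cong suc (All.lookup (sum₁-compositions 3 m) v∈)))

∈-enumeration⁺ : ∀ a s t c → block a s t c ∈ enumeration (a + (s + (t + c)))
-- All blocks without middle labels are represented by the one with `a = 0`.
∈-enumeration⁺ a zero    zero    c = here (block-merge a c)
∈-enumeration⁺ a zero    (suc t) c rewrite +-suc a (t + c) =
  there (∈-++⁺ˡ (∈-map⁺ straight (∈-compositions⁺ (a ∷ t ∷ c ∷ []))))
∈-enumeration⁺ a (suc s) t       c rewrite +-suc a (s + (t + c)) =
  there (∈-++⁺ʳ _ (∈-map⁺ delayed (∈-compositions⁺ (a ∷ s ∷ t ∷ c ∷ []))))

length-enumeration : ∀ n → length (enumeration n) ≡ ((suc n + 1) C 3) + (suc n C 2) + 1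
-- For size 1 both binomial coefficients vanish and only the trivial block remains.
length-enumeration zero    = refl
length-enumeration (suc m) = begin
  suc (length (map straight (compositions 2 m) ++ map delayed (compositions 3 m)))
    ≡⟨ cong suc (length-++ (map straight (compositions 2 m))) ⟩
  suc (length (map straight (compositions 2 m)) + length (map delayed (compositions 3 m)))
    ≡⟨ cong suc (cong₂ _+_ (length-map straight (compositions 2 m)) (length-map delayed (compositions 3 m))) ⟩
  suc (length (compositions 2 m) + length (compositions 3 m))
    ≡⟨ cong suc (cong₂ _+_ (length-compositions 2 m) (length-compositions 3 m)) ⟩
  suc ((m + 2) C 2 + (m + 3) C 3)
    ≡⟨ cong suc (cong₂ (λ p q → p C 2 + q C 3) (+-comm m 2) (trans (+-comm m 3) (sym (+-comm (2 + m) 1)))) ⟩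
  suc ((2 + m) C 2 + (2 + m + 1) C 3)
    ≡⟨ cong suc (+-comm ((2 + m) C 2) _) ⟩
  suc ((2 + m + 1) C 3 + (2 + m) C 2)
    ≡⟨ +-comm 1 _ ⟩
  (2 + m + 1) C 3 + (2 + m) C 2 + 1 ∎
  where open ≡-Reasoning

theorem18 : ∀ (n : ℕ) → n ≥ 1 →
    pf n ⟨ (1 ∷ 2 ∷ 3 ∷ []) ∷ (2 ∷ 3 ∷ 1 ∷ []) ∷ [] ⟩≐ (((n + 1) C 3) + (n C 2) + 1)
theorem18 (suc n) _ =
  enumeration n , enumeration-unique n , (λ w → mk⇔ (∈-enumeration⁻ n) (complete ∘ counted⇒block)) , length-enumeration n
  where
  complete : ∀ {w} → IsBlock n w → w ∈ enumeration n
  complete (a , s , t , c , refl , refl) = ∈-enumeration⁺ a s t c
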